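{- For all $n\geq 1$ and $m\geq 2$, $s_{n,m}(122,312)=(n-1)m+1$.
   Context: $[n]_m=\{1^m,\ldots,n^m\}$; a permutation of $[n]_m$ is a sequence of length $nm$ in which each element of $[n]$ appears exactly $m$ times. A sequence avoids a pattern $\pi$ if it has no subsequence order-isomorphic to $\pi$ (same relative order and same equalities among entries). $s_{n,m}(\Pi)$ is the number of permutations of $[n]_m$ avoiding all patterns in $\Pi$. -}

module Defs where

open import Data.Fin as Fin using (Fin)
import Data.Fin.Properties as Fin
open import Data.List using (List; []; _∷_; length; lookup; filter; allFin; cartesianProductWith)
open import Data.List.Membership.Propositional using (_∈_)
open import Data.List.Membership.Propositional.Properties
  using (∈-allFin; ∈-cartesianProductWith⁺; ∈-cartesianProductWith⁻)
open import Data.List.Properties using (∷-injective)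
open import Data.List.Relation.Binary.Sublist.Propositional using (_⊆_; []; _∷_; _∷ʳ_)
open import Data.List.Relation.Unary.All as All using (All; []; _∷_)
open import Data.List.Relation.Unary.Any using (here)
open import Data.List.Relation.Unary.Unique.Propositional using (Unique; []; _∷_)
import Data.List.Relation.Unary.Unique.Propositional.Properties as Unique
open import Data.Nat as ℕ using (ℕ; zero; suc; _*_)
open import Data.Product using (Σ-syntax; ∃-syntax; _×_; _,_)
open import Data.Sum using (_⊎_; inj₁; inj₂)
open import Function.Base using (case_of_)
open import Function.Bundles using (_⇔_; mk⇔; Equivalence)
open import Relation.Binary.PropositionalEquality using (_≡_; refl; cong)
open import Relation.Nullary using (¬_; Dec; yes; no)
open import Relation.Nullary.Decidable using (map′; _×-dec_; _→-dec_; _⊎-dec_; ¬?)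

private
  variable
    n k : ℕ

-- The letters 1, …, n are represented by Fin n, i.e. shifted to 0, …, n - 1.

Word : ℕ → Set
Word n = List (Fin n)

Pattern : Set
Pattern = List ℕ

occurrences : Fin n → Word n → ℕ
occurrences i σ = length (filter (Fin._≟ i) σ)

IsPermutation : (n m : ℕ) → Word n → Set
IsPermutation n m σ = length σ ≡ n * m × (∀ i → occurrences i σ ≡ m)

OrderIsomorphic : Pattern → Word n → Set
OrderIsomorphic π τ = Σ[ eq ∈ length π ≡ length τ ] ∀ i j →
  (lookup π i ℕ.< lookup π j ⇔ lookup τ (Fin.cast eq i) Fin.< lookup τ (Fin.cast eq j)) ×
  (lookup π i ≡ lookup π j ⇔ lookup τ (Fin.cast eq i) ≡ lookup τ (Fin.cast eq j))

Contains : Word n → Pattern → Set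
Contains σ π = ∃[ τ ] τ ⊆ σ × OrderIsomorphic π τ

Avoids : Word n → List Pattern → Set
Avoids σ Π = All (λ π → ¬ Contains σ π) Π

private
  _⇔-dec_ : {A B : Set} → Dec A → Dec B → Dec (A ⇔ B)
  a? ⇔-dec b? = map′ (λ (f , g) → mk⇔ f g)
    (λ e → Equivalence.to e , Equivalence.from e)
    ((a? →-dec b?) ×-dec (b? →-dec a?))

  anySublist? : {A : Set} {P : List A → Set} → (∀ τ → Dec (P τ)) →
                ∀ σ → Dec (∃[ τ ] τ ⊆ σ × P τ)
  anySublist? P? [] = map′ (λ p → [] , [] , p) (λ where (_ , [] , p) → p) (P? [])
  anySublist? {P = P} P? (x ∷ σ) = map′
    (λ where
      (inj₁ (τ , τ⊆σ , p)) → τ , x ∷ʳ τ⊆σ , p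
      (inj₂ (τ , τ⊆σ , p)) → x ∷ τ , refl ∷ τ⊆σ , p)
    (λ where
      (τ , _ ∷ʳ τ⊆σ , p) → inj₁ (τ , τ⊆σ , p)
      (_ , refl ∷ τ⊆σ , p) → inj₂ (_ , τ⊆σ , p))
    (anySublist? P? σ ⊎-dec anySublist? (λ τ → P? (x ∷ τ)) σ)

isPermutation? : ∀ n m (σ : Word n) → Dec (IsPermutation n m σ)
isPermutation? n m σ =
  (length σ ℕ.≟ n * m) ×-dec Fin.all? (λ i → occurrences i σ ℕ.≟ m)

orderIsomorphic? : ∀ π (τ : Word n) → Dec (OrderIsomorphic π τ)
orderIsomorphic? π τ with length π ℕ.≟ length τ
... | no neq = no λ (eq , _) → neq eq
... | yes eq = map′ (eq ,_) (λ (_ , iso) → iso)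
  (Fin.all? λ i → Fin.all? λ j →
    ((lookup π i ℕ.<? lookup π j) ⇔-dec
      (lookup τ (Fin.cast eq i) Fin.<? lookup τ (Fin.cast eq j))) ×-dec
    ((lookup π i ℕ.≟ lookup π j) ⇔-dec
      (lookup τ (Fin.cast eq i) Fin.≟ lookup τ (Fin.cast eq j))))

contains? : ∀ (σ : Word n) π → Dec (Contains σ π)
contains? σ π = anySublist? (orderIsomorphic? π) σ

avoids? : ∀ (σ : Word n) Π → Dec (Avoids σ Π)
avoids? σ Π = All.all? (λ π → ¬? (contains? σ π)) Π

words : ∀ n → ℕ → List (Word n)
words n zero    = [] ∷ []
words n (suc k) = cartesianProductWith _∷_ (allFin n) (words n k)

∈-words⁺ : ∀ (σ : Word n) → σ ∈ words n (length σ)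
∈-words⁺ []      = here refl
∈-words⁺ (x ∷ σ) = ∈-cartesianProductWith⁺ _∷_ (∈-allFin x) (∈-words⁺ σ)

∈-words⁻ : ∀ k {σ : Word n} → σ ∈ words n k → length σ ≡ k
∈-words⁻ zero (here refl) = refl
∈-words⁻ {n} (suc k) σ∈ =
  case ∈-cartesianProductWith⁻ _∷_ (allFin n) (words n k) σ∈ of λ where
    (_ , _ , _ , τ∈ , refl) → cong suc (∈-words⁻ k τ∈)

words-unique : ∀ n k → Unique (words n k)
words-unique n zero    = [] ∷ []
words-unique n (suc k) =
  Unique.cartesianProductWith⁺ _∷_ ∷-injective (Unique.allFin⁺ n) (words-unique n k)

-- words n (n * m) lists every candidate exactly once (∈-words⁺, words-unique),
-- so the length of the filtered list is the cardinality.
s : (n m : ℕ) → List Pattern → ℕ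
s n m Π = length (filter (λ σ → isPermutation? n m σ ×-dec avoids? σ Π) (words n (n * m)))

p122 : Pattern
p122 = 1 ∷ 2 ∷ 2 ∷ []

p312 : Pattern
p312 = 3 ∷ 1 ∷ 2 ∷ []

{-# OPTIONS --safe #-}

-- Let x be the largest letter and σ a word avoiding 122 and 312, with m ≥ 2.
-- Avoiding 122, at most one x follows any smaller letter, so σ starts with
-- m - 1 ≥ 1 copies of x. Avoiding 312, the smaller letters, all preceded by an
-- x, are weakly decreasing. Only the position of the last x among those
-- (n - 1) m letters is free, and each of the (n - 1) m + 1 choices is valid.
module Submission where

open import Defs
open import Data.Fin as Fin using (Fin; zero; suc; fromℕ; inject₁)
import Data.Fin.Properties as Fin
open import Data.Fin.Relation.Unary.Top using (view; ‵fromℕ; ‵inject₁)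
open import Data.List using (List; []; _∷_; _++_; length; map; filter; replicate)
open import Data.List.Membership.Propositional using (_∈_)
open import Data.List.Membership.Propositional.Properties
  using (∈-filter⁺; ∈-filter⁻; ∈-map⁺; ∈-map⁻)
open import Data.List.Membership.Propositional.Properties.WithK using (unique∧set⇒bag)
open import Data.List.Properties
  using ( length-map; length-++; length-replicate; filter-++; filter-all; filter-none
        ; filter-accept; filter-reject; ++-cancelˡ; ∷-injectiveˡ; ∷-injectiveʳ)
open import Data.List.Relation.Binary.BagAndSetEquality using (∼bag⇒↭)
open import Data.List.Relation.Binary.Permutation.Propositional
  using (_↭_; ↭-refl; ↭-trans; ↭-prep; ↭-swap)
open import Data.List.Relation.Binary.Permutation.Propositional.Properties
  using (↭-length; shift; ++⁺ˡ; filter-↭)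
open import Data.List.Relation.Binary.Sublist.Propositional
  using (_⊆_; []; _∷_; _∷ʳ_; ⊆-refl; ⊆-trans; minimum; from∈; to∈)
open import Data.List.Relation.Binary.Sublist.Propositional.Properties as Sublist
  using (filter⁺; filter-⊆; length-mono-≤; All-resp-⊆; ∷ˡ⁻)
open import Data.List.Relation.Unary.All as All using (All; []; _∷_)
import Data.List.Relation.Unary.All.Properties as All
open import Data.List.Relation.Unary.AllPairs as AllPairs using (AllPairs; []; _∷_)
import Data.List.Relation.Unary.AllPairs.Properties as AllPairs
open import Data.List.Relation.Unary.Any using (here; there)
open import Data.List.Relation.Unary.Unique.Propositional using (Unique)
import Data.List.Relation.Unary.Unique.Propositional.Properties as Unique
open import Data.Nat as ℕ using (ℕ; zero; suc; _+_; _*_; _∸_; _≤_; _≥_; z≤n; s≤s)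
import Data.Nat.Properties as ℕ
open import Data.Product using (∃-syntax; _×_; _,_; proj₁; proj₂)
open import Function.Base using (_∘_)
open import Function.Bundles using (_⇔_; mk⇔; Equivalence)
open import Relation.Binary.PropositionalEquality
  using (_≡_; _≢_; refl; sym; trans; cong; cong₂; subst; subst₂; module ≡-Reasoning)
open import Relation.Nullary using (¬_; Dec; yes; no; contradiction)
open import Relation.Nullary.Decidable using (¬?; _×-dec_)

private
  variable
    A : Set
    n k : ℕ
    x y a b c : A
    xs ys zs : List A
    σ τ : Word n

-- Inserting a letter into a list

insertions : A → List A → List (List A)
insertions x []       = (x ∷ []) ∷ []
insertions x (y ∷ ys) = (x ∷ y ∷ ys) ∷ map (y ∷_) (insertions x ys)

-- There is one entry for each gap of `ys`, and coinciding results are not merged, so no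
-- distinctness assumption enters here.
length-insertions : (x : A) (ys : List A) → length (insertions x ys) ≡ suc (length ys)
length-insertions x []       = refl
length-insertions x (y ∷ ys) =
  cong suc (trans (length-map (y ∷_) (insertions x ys)) (length-insertions x ys))

insertions-↭ : (ys : List A) → zs ∈ insertions x ys → zs ↭ x ∷ ys
insertions-↭ []       (here refl) = ↭-refl
insertions-↭ (y ∷ ys) (here refl) = ↭-refl
insertions-↭ (y ∷ ys) (there zs∈) with _ , ws∈ , refl ← ∈-map⁻ (y ∷_) zs∈ =
  ↭-trans (↭-prep y (insertions-↭ ys ws∈)) (↭-swap _ _ ↭-refl)

-- The first entry begins with `x` and all others with `y`, which differs from `x`; stripping that
-- common `y` reduces to the tail.
insertions-unique : All (_≢ x) ys → Unique (insertions x ys)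
insertions-unique []              = [] ∷ []
insertions-unique (y≢x ∷ ys≢x) =
  All.map⁺ (All.universal (λ _ → y≢x ∘ sym ∘ ∷-injectiveˡ) _) ∷
  Unique.map⁺ ∷-injectiveʳ (insertions-unique ys≢x)

-- Erasing a letter and counting occurrences

_≢?_ : (x y : Fin n) → Dec (x ≢ y)
x ≢? y = ¬? (x Fin.≟ y)

erase : Fin n → Word n → Word n
erase x = filter (_≢? x)

erase-insertion : All (_≢ x) σ → τ ∈ insertions x σ → erase x τ ≡ σ
erase-insertion {x = x} [] (here refl) = filter-reject (_≢? x) λ x≢x → x≢x refl
erase-insertion {x = x} σ≢x@(_ ∷ _) (here refl) =
  trans (filter-reject (_≢? x) λ x≢x → x≢x refl) (filter-all (_≢? x) σ≢x)
erase-insertion {x = x} {σ = y ∷ _} (y≢x ∷ σ≢x) (there τ∈)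
  with _ , ρ∈ , refl ← ∈-map⁻ (y ∷_) τ∈ =
  trans (filter-accept (_≢? x) y≢x) (cong (y ∷_) (erase-insertion σ≢x ρ∈))

occurrences-∷-≡ : (x : Fin n) (σ : Word n) →
                  occurrences x (x ∷ σ) ≡ suc (occurrences x σ)
occurrences-∷-≡ x σ = cong length (filter-accept (Fin._≟ x) refl)

occurrences-∷-≢ : y ≢ x → (σ : Word n) → occurrences x (y ∷ σ) ≡ occurrences x σ
occurrences-∷-≢ {x = x} y≢x σ = cong length (filter-reject (Fin._≟ x) y≢x)

occurrences-++ : (x : Fin n) (σ τ : Word n) →
                 occurrences x (σ ++ τ) ≡ occurrences x σ + occurrences x τ
occurrences-++ x σ τ =
  trans (cong length (filter-++ (Fin._≟ x) σ τ)) (length-++ (filter (Fin._≟ x) σ))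

occurrences-↭ : (x : Fin n) → σ ↭ τ → occurrences x σ ≡ occurrences x τ
occurrences-↭ x σ↭τ = ↭-length (filter-↭ (Fin._≟ x) σ↭τ)

occurrences-∉ : All (_≢ x) σ → occurrences x σ ≡ 0
occurrences-∉ {x = x} σ≢x = cong length (filter-none (Fin._≟ x) σ≢x)

occurrences-replicate : ∀ k (x : Fin n) → occurrences x (replicate k x) ≡ k
occurrences-replicate k x =
  trans (cong length (filter-all (Fin._≟ x) (All.replicate⁺ k refl))) (length-replicate k)

occurrences⇒∈ : (σ : Word n) → occurrences x σ ≡ suc k → x ∈ σ
occurrences⇒∈ {x = x} (y ∷ σ) eq with y Fin.≟ x
... | yes refl = here refl
... | no  _    = there (occurrences⇒∈ σ eq)

occurrences-erase : x ≢ y → (σ : Word n) → occurrences x (erase y σ) ≡ occurrences x σ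
occurrences-erase x≢y [] = refl
occurrences-erase {x = x} {y = y} x≢y (z ∷ σ) with z Fin.≟ y
... | yes refl = trans (occurrences-erase x≢y σ) (sym (occurrences-∷-≢ (x≢y ∘ sym) σ))
... | no  _ with z Fin.≟ x
...   | yes _ = cong suc (occurrences-erase x≢y σ)
...   | no  _ = occurrences-erase x≢y σ

-- Erasure sends the count of `x` to 0 on both sides and leaves every other count alone.
occurrences-erase-cong : (x : Fin n) → (∀ i → occurrences i σ ≡ occurrences i τ) →
                         ∀ i → occurrences i (erase x σ) ≡ occurrences i (erase x τ)
occurrences-erase-cong {σ = σ} {τ = τ} x eq i with i Fin.≟ x
... | yes refl = trans (occurrences-∉ (All.all-filter (_≢? x) σ)) (sym (occurrences-∉ (All.all-filter (_≢? x) τ)))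
... | no  i≢x  = trans (occurrences-erase i≢x σ) (trans (eq i) (sym (occurrences-erase i≢x τ)))

erase-replicate-++ : ∀ k (x : Fin n) σ → erase x (replicate k x ++ σ) ≡ erase x σ
erase-replicate-++ k x σ =
  trans (filter-++ (_≢? x) (replicate k x) σ)
        (cong (_++ erase x σ) (filter-none (_≢? x) (All.replicate⁺ k λ x≢x → x≢x refl)))

-- Counterpart of `erase-insertion`: behind its only `x` the word has no further `x`, so erasing
-- removes just that one letter, and reinserting it at the same gap restores the word.
∈-insertions-erase : (x : Fin n) (σ : Word n) → occurrences x σ ≡ 1 →
                     σ ∈ insertions x (erase x σ)
∈-insertions-erase x (y ∷ σ) eq with y Fin.≟ x
... | no  _    = there (∈-map⁺ (y ∷_) (∈-insertions-erase x σ eq))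
... | yes refl = subst (λ ρ → y ∷ σ ∈ insertions y ρ) (sym (filter-all (_≢? y) (absent σ (ℕ.suc-injective eq))))
                   (here-insertion σ)
  where
  absent : ∀ σ → occurrences y σ ≡ 0 → All (_≢ y) σ
  absent []      _  = []
  absent (z ∷ σ) eq with z Fin.≟ y
  ... | no z≢y = z≢y ∷ absent σ eq
  here-insertion : ∀ σ → y ∷ σ ∈ insertions y σ
  here-insertion []      = here refl
  here-insertion (_ ∷ _) = here refl

-- Sublists and runs of one letter

replicate-⊆ : ∀ k (σ : Word n) → k ≤ occurrences x σ → replicate k x ⊆ σ
replicate-⊆ zero    σ _ = minimum σ
replicate-⊆ {x = x} (suc k) (y ∷ σ) k< with y Fin.≟ x
... | yes refl = refl ∷ replicate-⊆ k σ (ℕ.s≤s⁻¹ k<)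
... | no  _    = y ∷ʳ replicate-⊆ (suc k) σ k<

-- An embedding cannot send `a` into the run of `x`, and everything after `a` lands further right
-- still.
⊆-replicate-++⁻ : ∀ k → a ≢ x → a ∷ xs ⊆ replicate k x ++ ys → a ∷ xs ⊆ ys
⊆-replicate-++⁻ zero    a≢x p          = p
⊆-replicate-++⁻ (suc k) a≢x (_ ∷ʳ p)   = ⊆-replicate-++⁻ k a≢x p
⊆-replicate-++⁻ (suc k) a≢x (a≡x ∷ _) = contradiction a≡x a≢x

-- Weakly decreasing words

Descending : Word n → Set
Descending = AllPairs Fin._≥_

-- With `≥⇒Descending`, this translates between pairwise order and two-letter sublists, the form in
-- which pattern occurrences supply comparisons.
Descending⇒≥ : Descending σ → a ∷ b ∷ [] ⊆ σ → b Fin.≤ a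
Descending⇒≥ (_ ∷ d)   (_ ∷ʳ p)   = Descending⇒≥ d p
Descending⇒≥ (a≥ ∷ _) (refl ∷ p) with b≤a ∷ [] ← All-resp-⊆ p a≥ = b≤a

≥⇒Descending : (σ : Word n) → (∀ {a b} → a ∷ b ∷ [] ⊆ σ → b Fin.≤ a) → Descending σ
≥⇒Descending []      _ = []
≥⇒Descending (x ∷ σ) h =
  All.tabulate (λ y∈ → h (refl ∷ from∈ y∈)) ∷ ≥⇒Descending σ (λ p → h (x ∷ʳ p))

-- Each head is the maximum of its word and, by the counts, occurs in the other word, so the heads
-- agree by antisymmetry. Removing them keeps the counts equal.
Descending-unique : Descending σ → Descending τ →
                    (∀ i → occurrences i σ ≡ occurrences i τ) → σ ≡ τ
Descending-unique [] [] _ = refl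
Descending-unique [] (_∷_ {y} {τ} _ _) eq with () ← trans (eq y) (occurrences-∷-≡ y τ)
Descending-unique (_∷_ {x} {σ} _ _) [] eq with () ← trans (sym (eq x)) (occurrences-∷-≡ x σ)
Descending-unique (_∷_ {x} {σ} x≥ dσ) (_∷_ {y} {τ} y≥ dτ) eq
  with refl ← Fin.≤-antisym
    (All.lookup (Fin.≤-refl ∷ y≥) (occurrences⇒∈ (y ∷ τ) (trans (sym (eq x)) (occurrences-∷-≡ x σ))))
    (All.lookup (Fin.≤-refl ∷ x≥) (occurrences⇒∈ (x ∷ σ) (trans (eq y) (occurrences-∷-≡ y τ))))
  = cong (x ∷_) (Descending-unique dσ dτ tail-eq)
  where
  tail-eq : ∀ i → occurrences i σ ≡ occurrences i τ
  tail-eq i with x Fin.≟ i | eq i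
  ... | yes _ | e = ℕ.suc-injective e
  ... | no  _ | e = e

-- The only weakly decreasing permutation, by `Descending-unique`. Recursion on the largest letter
-- makes its leading block visible by computation.
descending : ∀ n → ℕ → Word n
descending zero    m = []
descending (suc n) m = replicate m (fromℕ n) ++ map inject₁ (descending n m)

inject₁-≢-fromℕ : (σ : Word n) → All (_≢ fromℕ n) (map inject₁ σ)
inject₁-≢-fromℕ σ = All.map⁺ (All.universal (λ _ → Fin.fromℕ≢inject₁ ∘ sym) σ)

occurrences-inject₁ : (i : Fin n) (σ : Word n) →
                      occurrences (inject₁ i) (map inject₁ σ) ≡ occurrences i σ
occurrences-inject₁ i [] = refl
occurrences-inject₁ i (y ∷ σ) with y Fin.≟ i
... | yes refl = trans (occurrences-∷-≡ (inject₁ i) _) (cong suc (occurrences-inject₁ i σ))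
... | no  y≢i  = trans (occurrences-∷-≢ (y≢i ∘ Fin.inject₁-injective) _) (occurrences-inject₁ i σ)

descending-isPermutation : ∀ n m → IsPermutation n m (descending n m)
descending-isPermutation zero    m = refl , λ ()
descending-isPermutation (suc n) m = length≡ , occurrences≡
  where
  open ≡-Reasoning
  ξ = descending n m

  length≡ : length (descending (suc n) m) ≡ suc n * m
  length≡ = begin
    length (replicate m (fromℕ n) ++ map inject₁ ξ)
      ≡⟨ length-++ (replicate m (fromℕ n)) ⟩
    length (replicate m (fromℕ n)) + length (map inject₁ ξ)
      ≡⟨ cong₂ _+_ (length-replicate m) (length-map inject₁ ξ) ⟩
    m + length ξ
      ≡⟨ cong (m +_) (proj₁ (descending-isPermutation n m)) ⟩
    m + n * m ∎

  occurrences≡ : ∀ i → occurrences i (descending (suc n) m) ≡ m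
  occurrences≡ i with view i
  ... | ‵fromℕ = begin
    occurrences (fromℕ n) (descending (suc n) m)
      ≡⟨ occurrences-++ _ (replicate m (fromℕ n)) _ ⟩
    occurrences (fromℕ n) (replicate m (fromℕ n)) + occurrences (fromℕ n) (map inject₁ ξ)
      ≡⟨ cong₂ _+_ (occurrences-replicate m _) (occurrences-∉ (inject₁-≢-fromℕ ξ)) ⟩
    m + 0
      ≡⟨ ℕ.+-identityʳ m ⟩
    m ∎
  ... | ‵inject₁ j = begin
    occurrences (inject₁ j) (descending (suc n) m)
      ≡⟨ occurrences-++ _ (replicate m (fromℕ n)) _ ⟩
    occurrences (inject₁ j) (replicate m (fromℕ n)) + occurrences (inject₁ j) (map inject₁ ξ)
      ≡⟨ cong₂ _+_ (occurrences-∉ (All.replicate⁺ m Fin.fromℕ≢inject₁)) (occurrences-inject₁ j ξ) ⟩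
    occurrences j ξ
      ≡⟨ proj₂ (descending-isPermutation n m) j ⟩
    m ∎

inject₁-Descending : Descending σ → Descending (map inject₁ σ)
inject₁-Descending = AllPairs.map⁺ ∘ AllPairs.map
  (subst₂ ℕ._≤_ (sym (Fin.toℕ-inject₁ _)) (sym (Fin.toℕ-inject₁ _)))

descending-Descending : ∀ n m → Descending (descending n m)
descending-Descending zero    m = []
descending-Descending (suc n) m = AllPairs.++⁺
  (constant m)
  (inject₁-Descending (descending-Descending n m))
  (All.replicate⁺ m (All.universal Fin.≤fromℕ _))
  where
  constant : ∀ k → Descending (replicate k (fromℕ n))
  constant zero    = []
  constant (suc k) = All.replicate⁺ k Fin.≤-refl ∷ constant k

-- Occurrences of 122 and 312 as inequalities

module _ {p q : ℕ} {a b : Fin n} where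
  private
    -- The condition that `OrderIsomorphic` puts on one pair of positions. The three lemmas below
    -- cover the outcomes of trichotomy: a shared outcome settles both equivalences.
    SameOrder = (p ℕ.< q ⇔ a Fin.< b) × (p ≡ q ⇔ a ≡ b)

  both-< : p ℕ.< q → a Fin.< b → SameOrder
  both-< p<q a<b = mk⇔ (λ _ → a<b) (λ _ → p<q) ,
    mk⇔ (λ p≡q → contradiction p≡q (ℕ.<⇒≢ p<q)) (λ a≡b → contradiction a≡b (Fin.<⇒≢ a<b))

  both-> : q ℕ.< p → b Fin.< a → SameOrder
  both-> q<p b<a =
    mk⇔ (λ p<q → contradiction p<q (ℕ.<-asym q<p)) (λ a<b → contradiction a<b (Fin.<-asym b<a)) ,
    mk⇔ (λ p≡q → contradiction (sym p≡q) (ℕ.<⇒≢ q<p)) (λ a≡b → contradiction (sym a≡b) (Fin.<⇒≢ b<a))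

  both-≡ : p ≡ q → a ≡ b → SameOrder
  both-≡ p≡q a≡b =
    mk⇔ (λ p<q → contradiction p≡q (ℕ.<⇒≢ p<q)) (λ a<b → contradiction a≡b (Fin.<⇒≢ a<b)) ,
    mk⇔ (λ _ → a≡b) (λ _ → p≡q)

contains-122⁺ : a Fin.< b → a ∷ b ∷ b ∷ [] ⊆ σ → Contains σ p122
contains-122⁺ {a = a} {b = b} a<b p = a ∷ b ∷ b ∷ [] , p , refl , order
  where
  1<2 : 1 ℕ.< 2
  1<2 = s≤s (s≤s z≤n)
  order : _
  order zero             zero             = both-≡ refl refl
  order zero             (suc zero)       = both-< 1<2 a<b
  order zero             (suc (suc zero)) = both-< 1<2 a<b
  order (suc zero)       zero             = both-> 1<2 a<b
  order (suc zero)       (suc zero)       = both-≡ refl refl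
  order (suc zero)       (suc (suc zero)) = both-≡ refl refl
  order (suc (suc zero)) zero             = both-> 1<2 a<b
  order (suc (suc zero)) (suc zero)       = both-≡ refl refl
  order (suc (suc zero)) (suc (suc zero)) = both-≡ refl refl

contains-122⁻ : Contains σ p122 → ∃[ a ] ∃[ b ] a Fin.< b × a ∷ b ∷ b ∷ [] ⊆ σ
contains-122⁻ (a ∷ b ∷ c ∷ [] , p , refl , order)
  with refl ← Equivalence.to (proj₂ (order (suc zero) (suc (suc zero)))) refl =
  a , b , Equivalence.to (proj₁ (order zero (suc zero))) (s≤s (s≤s z≤n)) , p

contains-312⁺ : b Fin.< c → c Fin.< a → a ∷ b ∷ c ∷ [] ⊆ σ → Contains σ p312
contains-312⁺ {b = b} {c = c} {a = a} b<c c<a p = a ∷ b ∷ c ∷ [] , p , refl , order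
  where
  1<2 : 1 ℕ.< 2
  1<2 = s≤s (s≤s z≤n)
  2<3 : 2 ℕ.< 3
  2<3 = s≤s 1<2
  1<3 : 1 ℕ.< 3
  1<3 = s≤s (s≤s z≤n)
  order : _
  order zero             zero             = both-≡ refl refl
  order zero             (suc zero)       = both-> 1<3 (Fin.<-trans b<c c<a)
  order zero             (suc (suc zero)) = both-> 2<3 c<a
  order (suc zero)       zero             = both-< 1<3 (Fin.<-trans b<c c<a)
  order (suc zero)       (suc zero)       = both-≡ refl refl
  order (suc zero)       (suc (suc zero)) = both-< 1<2 b<c
  order (suc (suc zero)) zero             = both-< 2<3 c<a
  order (suc (suc zero)) (suc zero)       = both-> 1<2 b<c
  order (suc (suc zero)) (suc (suc zero)) = both-≡ refl refl

contains-312⁻ : Contains σ p312 →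
                ∃[ a ] ∃[ b ] ∃[ c ] b Fin.< c × c Fin.< a × a ∷ b ∷ c ∷ [] ⊆ σ
contains-312⁻ (a ∷ b ∷ c ∷ [] , p , refl , order) =
  a , b , c ,
  Equivalence.to (proj₁ (order (suc zero) (suc (suc zero)))) (s≤s (s≤s z≤n)) ,
  Equivalence.to (proj₁ (order (suc (suc zero)) zero)) (s≤s (s≤s (s≤s z≤n))) , p

-- The candidate words and their validity

-- The words described at the top, for n + 1 letters and m = suc k.
candidates : ∀ n → ℕ → List (Word (suc n))
candidates n k =
  map (replicate k (fromℕ n) ++_) (insertions (fromℕ n) (map inject₁ (descending n (suc k))))

length-candidates : ∀ n k → length (candidates n k) ≡ n * suc k + 1
length-candidates n k = begin
  length (candidates n k)                         ≡⟨ length-map (replicate k (fromℕ n) ++_) (insertions _ ξ) ⟩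
  length (insertions (fromℕ n) ξ)                 ≡⟨ length-insertions (fromℕ n) ξ ⟩
  suc (length ξ)                                  ≡⟨ cong suc (length-map inject₁ (descending n (suc k))) ⟩
  suc (length (descending n (suc k)))             ≡⟨ cong suc (proj₁ (descending-isPermutation n (suc k))) ⟩
  suc (n * suc k)                                 ≡⟨ ℕ.+-comm 1 (n * suc k) ⟩
  n * suc k + 1                                   ∎
  where
  open ≡-Reasoning
  ξ = map inject₁ (descending n (suc k))

candidates-unique : ∀ n k → Unique (candidates n k)
candidates-unique n k = Unique.map⁺ (++-cancelˡ (replicate k (fromℕ n)) _ _)
  (insertions-unique (inject₁-≢-fromℕ (descending n (suc k))))

<fromℕ : {i : Fin (suc n)} → i ≢ fromℕ n → i Fin.< fromℕ n
<fromℕ = Fin.≤∧≢⇒< (Fin.≤fromℕ _)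

<⇒≢fromℕ : {i j : Fin (suc n)} → i Fin.< j → i ≢ fromℕ n
<⇒≢fromℕ i<j refl = ℕ.<⇒≱ i<j (Fin.≤fromℕ _)

candidate-isPermutation : ∀ n k {σ : Word (suc n)} → σ ∈ candidates n k → IsPermutation (suc n) (suc k) σ
candidate-isPermutation n k σ∈
  with _ , τ∈ , refl ← ∈-map⁻ (replicate k (fromℕ n) ++_) σ∈ =
  trans (↭-length σ↭δ) (proj₁ δ-perm) ,
  λ i → trans (occurrences-↭ i σ↭δ) (proj₂ δ-perm i)
  where
  δ-perm = descending-isPermutation (suc n) (suc k)
  -- The inserted copy moves to the front of the smaller letters, then past the run of `k` copies;
  -- the result is `descending (suc n) (suc k)` by computation.
  σ↭δ = ↭-trans (++⁺ˡ (replicate k (fromℕ n)) (insertions-↭ _ τ∈))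
                (shift (fromℕ n) (replicate k (fromℕ n)) _)

-- In a 312 the last two letters form an ascent below the largest letter. A 122 either is such an
-- ascent or needs two largest letters after a smaller one. Neither exists, since the smaller
-- letters decrease and only one largest letter lies outside the initial run.
candidate-avoids : ∀ n k {σ : Word (suc n)} → σ ∈ candidates n k → Avoids σ (p122 ∷ p312 ∷ [])
candidate-avoids n k {σ} σ∈
  with τ , τ∈ , refl ← ∈-map⁻ (replicate k (fromℕ n) ++_) σ∈ = no-122 ∷ no-312 ∷ []
  where
  top = fromℕ n
  δ = map inject₁ (descending n (suc k))
  δ≢top = inject₁-≢-fromℕ (descending n (suc k))

  -- Erasing `top` keeps both letters of the pair and turns `σ` into the decreasing word `δ`.
  no-ascent : b Fin.< c → b ≢ top → c ≢ top → ¬ (b ∷ c ∷ [] ⊆ σ)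
  no-ascent {b} {c} b<c b≢top c≢top p = ℕ.<⇒≱ b<c (Descending⇒≥ (inject₁-Descending (descending-Descending n (suc k)))
    (subst (b ∷ c ∷ [] ⊆_) (trans (erase-replicate-++ k top τ) (erase-insertion δ≢top τ∈))
      (subst (_⊆ erase top σ) (filter-all (_≢? top) (b≢top ∷ c≢top ∷ [])) (filter⁺ (_≢? top) (_≢? top) (λ { refl → λ z → z }) p))))

  occurrences-top : occurrences top τ ≡ 1
  occurrences-top = begin
    occurrences top τ         ≡⟨ occurrences-↭ top (insertions-↭ _ τ∈) ⟩
    occurrences top (top ∷ δ)   ≡⟨ occurrences-∷-≡ top δ ⟩
    suc (occurrences top δ)   ≡⟨ cong suc (occurrences-∉ δ≢top) ⟩
    1                       ∎
    where open ≡-Reasoning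

  no-top-top : ¬ (top ∷ top ∷ [] ⊆ τ)
  no-top-top p = ℕ.<⇒≱ {1} {2} ℕ.≤-refl (begin
    2                             ≡⟨ occurrences-replicate 2 top ⟨
    occurrences top (top ∷ top ∷ [])    ≤⟨ length-mono-≤ (filter⁺ (Fin._≟ top) (Fin._≟ top) (λ { refl z → z }) p) ⟩
    occurrences top τ               ≡⟨ occurrences-top ⟩
    1                             ∎)
    where open ℕ.≤-Reasoning

  no-122 : ¬ Contains σ p122
  no-122 C with contains-122⁻ C
  ... | a , b , a<b , p with b Fin.≟ top
  -- The smaller letter `a` lies beyond the initial run, so both copies of `top` after it lie in
  -- `τ`.
  ...   | yes refl = no-top-top (∷ˡ⁻ (⊆-replicate-++⁻ k (<⇒≢fromℕ a<b) p))
  ...   | no  b≢top  = no-ascent a<b (<⇒≢fromℕ a<b) b≢top (⊆-trans (refl ∷ refl ∷ minimum _) p)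

  no-312 : ¬ Contains σ p312
  no-312 C with a , b , c , b<c , c<a , p ← contains-312⁻ C =
    no-ascent b<c (<⇒≢fromℕ b<c) (<⇒≢fromℕ c<a) (∷ˡ⁻ p)

-- Completeness of the candidates and the count

-- Two copies of the largest letter x cannot follow a smaller letter, so only
-- the last copy of x can be preceded by one.
replicate-prefix : ∀ k (σ : Word (suc n)) → occurrences (fromℕ n) σ ≡ suc k →
                   ¬ Contains σ p122 →
                   ∃[ τ ] σ ≡ replicate k (fromℕ n) ++ τ × occurrences (fromℕ n) τ ≡ 1
replicate-prefix zero    σ eq _ = σ , refl , eq
replicate-prefix {n} (suc k) (y ∷ σ) eq no-122 with y Fin.≟ fromℕ n
... | yes refl
  with τ , refl , τ-eq ← replicate-prefix k σ (ℕ.suc-injective eq)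
         (λ (ρ , p , iso) → no-122 (ρ , y ∷ʳ p , iso)) = τ , refl , τ-eq
... | no  y≢x  = contradiction
  (contains-122⁺ (<fromℕ y≢x) (refl ∷ replicate-⊆ 2 σ (subst (2 ≤_) (sym eq) (s≤s (s≤s z≤n))))) no-122

-- Multiplicity at least 2 makes the forced initial run nonempty, so every other letter has a
-- largest letter before it. This fixes the order of the smaller letters and leaves free only the
-- gap of the last largest letter.
candidates-complete : ∀ n k {σ : Word (suc n)} → IsPermutation (suc n) (suc (suc k)) σ →
                      Avoids σ (p122 ∷ p312 ∷ []) → σ ∈ candidates n (suc k)
candidates-complete n k {σ} (_ , σ-occ) (no-122 ∷ no-312 ∷ [])
  with τ , refl , τ-occ ← replicate-prefix (suc k) σ (σ-occ (fromℕ n)) no-122 =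
  ∈-map⁺ (replicate (suc k) top ++_)
    (subst (λ ρ → τ ∈ insertions top ρ) erase-τ (∈-insertions-erase top τ τ-occ))
  where
  top = fromℕ n
  δ = descending n (suc (suc k))

  -- The word starts with top, so an ascent below top would complete a 312.
  τ-descending : Descending (erase top τ)
  τ-descending = ≥⇒Descending (erase top τ) λ p → ℕ.≮⇒≥ λ b<c →
    no-312 (contains-312⁺ b<c (<fromℕ (All.lookup (All.all-filter (_≢? top) τ) (to∈ (∷ˡ⁻ p))))
      (refl ∷ ⊆-trans p (⊆-trans (filter-⊆ (_≢? top) τ) (Sublist.++⁺ˡ (replicate k top) ⊆-refl))))

  -- Both sides decrease, so equal counts suffice. Counts are compared on the whole permutations `σ`
  -- and `descending (suc n) (suc (suc k))`, and erasing `top` then deletes their initial runs.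
  erase-τ : erase top τ ≡ map inject₁ δ
  erase-τ = Descending-unique τ-descending
    (inject₁-Descending (descending-Descending n (suc (suc k))))
    λ i → begin
      occurrences i (erase top τ)
        ≡⟨ cong (occurrences i) (erase-replicate-++ (suc k) top τ) ⟨
      occurrences i (erase top σ)
        ≡⟨ occurrences-erase-cong {σ = σ} {τ = descending (suc n) (suc (suc k))} top
             (λ j → trans (σ-occ j) (sym (proj₂ (descending-isPermutation (suc n) (suc (suc k))) j))) i ⟩
      occurrences i (erase top (descending (suc n) (suc (suc k))))
        ≡⟨ cong (occurrences i) (erase-replicate-++ (suc (suc k)) top (map inject₁ δ)) ⟩
      occurrences i (erase top (map inject₁ δ))
        ≡⟨ cong (occurrences i) (filter-all (_≢? top) (inject₁-≢-fromℕ δ)) ⟩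
      occurrences i (map inject₁ δ) ∎
    where open ≡-Reasoning

-- The filtered list and the candidates are both free of duplicates and have the same members, so
-- each is a rearrangement of the other and their lengths agree.
theorem7 : ∀ (n m : ℕ) → n ≥ 1 → m ≥ 2 →
    s n m (p122 ∷ p312 ∷ []) ≡ (n ∸ 1) * m + 1
theorem7 (suc n) (suc zero) _ (s≤s ())
theorem7 (suc n) (suc (suc k)) _ _ = trans
  (↭-length (∼bag⇒↭ {x = filter P? (words (suc n) (suc n * m))} (unique∧set⇒bag
    (Unique.filter⁺ P? (words-unique (suc n) (suc n * m)))
    (candidates-unique n (suc k))
    (mk⇔ to from))))
  (length-candidates n (suc k))
  where
  m = suc (suc k)
  Π = p122 ∷ p312 ∷ []
  P? = λ σ → isPermutation? (suc n) m σ ×-dec avoids? σ Π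

  to : {σ : Word (suc n)} → σ ∈ filter P? (words (suc n) (suc n * m)) → σ ∈ candidates n (suc k)
  to σ∈ with _ , perm , avoids ← ∈-filter⁻ P? {xs = words (suc n) (suc n * m)} σ∈ =
    candidates-complete n k perm avoids

  from : {σ : Word (suc n)} → σ ∈ candidates n (suc k) → σ ∈ filter P? (words (suc n) (suc n * m))
  from {σ} σ∈ = ∈-filter⁺ P?
    (subst (λ l → σ ∈ words (suc n) l) (proj₁ perm) (∈-words⁺ σ))
    (perm , candidate-avoids n (suc k) σ∈)
    where perm = candidate-isPermutation n (suc k) σ∈
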